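{- Define $f:(\mathbb Z_{\ge0}^2\setminus\{(0,0)\})\times\mathbb Z^2\to\mathbb Z[x_{i,j}^{\pm1}]$ by $f(t,k+1-t,i,j):=\psi_{t,k}(x_{i,j})$. Then $f$ extends to $\mathbb Z_{\ge0}^2\times\mathbb Z^2$ (by $f(0,0,i,j)=x_{i,j}$), with $f(0,b,i,j)=f(a,0,i,j)=x_{i,j}$ for all $a,b\ge0$, so that the discrete 4D Hirota–Miwa equation holds: for all $a,b\in\mathbb Z_{\ge0}$ and $i,j\in\mathbb Z$, $$f(a+1,b+1,i,j)\,f(a,b,i,j)=f(a+1,b,i-1,j)\,f(a,b+1,i+1,j)+f(a,b+1,i,j-1)\,f(a+1,b,i,j+1).$$
   Context: Let $x_{i,j}$, $(i,j)\in\mathbb Z^2$, be independent variables. For integers $k\ge0$, $0\le t\le k+1$, define $\psi_{t,k}(x_{i,j})$ (Laurent polynomials in the variables) recursively by $\psi_{0,k}(x_{i,j})=\psi_{k+1,k}(x_{i,j})=x_{i,j}$, $$\psi_{1,1}(x_{i,j})=\frac{x_{i-1,j}x_{i+1,j}+x_{i,j-1}x_{i,j+1}}{x_{i,j}},$$ $$\psi_{t+1,k+2}(x_{i,j})=\frac{\psi_{t+1,k+1}(x_{i-1,j})\psi_{t,k+1}(x_{i+1,j})+\psi_{t,k+1}(x_{i,j-1})\psi_{t+1,k+1}(x_{i,j+1})}{\psi_{t,k}(x_{i,j})}\qquad(k\ge 0,\ 0\le t\le k+1).$$ -}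

module Defs where

open import Algebra.Bundles using (CommutativeRing)
open import Data.Fin.Base using (Fin; zero; suc; fromℕ; inject₁)
open import Data.Fin.Relation.Unary.Top using (view; ‵fromℕ; ‵inject₁)
open import Data.Integer.Base as ℤ using (ℤ; 1ℤ)
open import Data.Nat.Base using (ℕ; zero; suc)
open import Data.Product.Base using (_×_; _,_)
open import Level using (0ℓ)
open import Relation.Nullary.Negation.Core using (¬_)

-- ℤ[x i j ^ ±1 | (i , j) ∈ ℤ²], presented as the free commutative ring on the
-- x i j and x⁻¹ i j, modulo x i j * x⁻¹ i j = 1: the carrier consists of ring
-- expressions and _≈_ is the least ring congruence containing these relations.
-- Freeness makes the x i j independent.

infix  8 -_
infixl 7 _*_
infixl 6 _+_
infix  4 _≈_ _≉_

data Laurent : Set where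
  x x⁻¹   : (i j : ℤ) → Laurent
  0# 1#   : Laurent
  _+_ _*_ : Laurent → Laurent → Laurent
  -_      : Laurent → Laurent

private
  variable
    p p′ q q′ r : Laurent

data _≈_ : Laurent → Laurent → Set where
  refl        : p ≈ p
  sym         : p ≈ q → q ≈ p
  trans       : p ≈ q → q ≈ r → p ≈ r
  +-cong      : p ≈ p′ → q ≈ q′ → p + q ≈ p′ + q′
  *-cong      : p ≈ p′ → q ≈ q′ → p * q ≈ p′ * q′
  -‿cong      : p ≈ q → - p ≈ - q
  +-assoc     : ∀ p q r → (p + q) + r ≈ p + (q + r)
  +-comm      : ∀ p q → p + q ≈ q + p
  +-identityˡ : ∀ p → 0# + p ≈ p
  -‿inverseˡ  : ∀ p → - p + p ≈ 0#
  *-assoc     : ∀ p q r → (p * q) * r ≈ p * (q * r)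
  *-comm      : ∀ p q → p * q ≈ q * p
  *-identityˡ : ∀ p → 1# * p ≈ p
  distribˡ    : ∀ p q r → p * (q + r) ≈ p * q + p * r
  x-inverseʳ  : ∀ i j → x i j * x⁻¹ i j ≈ 1#

_≉_ : Laurent → Laurent → Set
p ≉ q = ¬ (p ≈ q)

laurentRing : CommutativeRing 0ℓ 0ℓ
laurentRing = record
  { Carrier = Laurent ; _≈_ = _≈_ ; _+_ = _+_ ; _*_ = _*_ ; -_ = -_ ; 0# = 0# ; 1# = 1#
  ; isCommutativeRing = record
    { isRing = record
      { +-isAbelianGroup = record
        { isGroup = record
          { isMonoid = record
            { isSemigroup = record
              { isMagma = record
                { isEquivalence = record { refl = refl ; sym = sym ; trans = trans }
                ; ∙-cong = +-cong }
              ; assoc = +-assoc }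
            ; identity = +-identityˡ , λ p → trans (+-comm p 0#) (+-identityˡ p) }
          ; inverse = -‿inverseˡ , λ p → trans (+-comm p (- p)) (-‿inverseˡ p)
          ; ⁻¹-cong = -‿cong }
        ; comm = +-comm }
      ; *-cong = *-cong
      ; *-assoc = *-assoc
      ; *-identity = *-identityˡ , λ p → trans (*-comm p 1#) (*-identityˡ p)
      ; distrib = distribˡ , λ p q r →
          trans (*-comm (q + r) p)
            (trans (distribˡ p q r) (+-cong (*-comm p q) (*-comm p r))) }
    ; *-comm = *-comm } }

-- Rational functions in the x i j, as formal fractions with the usual
-- arithmetic.  Denominators are not constrained here; that they are nonzero is
-- part of _≐_.

infix 5 _/_

record Fraction : Set where
  constructor _/_
  field
    num den : Laurent

open Fraction public

infixl 7 _·_ _÷_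
infixl 6 _⊕_

_⊕_ _·_ _÷_ : Fraction → Fraction → Fraction
(n / d) ⊕ (n′ / d′) = n * d′ + n′ * d / d * d′
(n / d) · (n′ / d′) = n * n′ / d * d′
(n / d) ÷ (n′ / d′) = n * d′ / d * n′

-- p ≐ u : the rational function u is defined and equals the Laurent polynomial p.

infix 4 _≐_

_≐_ : Laurent → Fraction → Set
p ≐ u = den u ≉ 0# × p * den u ≈ num u

X : (i j : ℤ) → Fraction
X i j = x i j / 1#

-- ψ k t i j is ψ_{t,k}(x_{i,j}).  The bound 0 ≤ t ≤ k+1 is t : Fin (2 + k), and
-- the view of t (where the index is suc t) splits off the top value k+1.

ψ : (k : ℕ) → Fin (suc (suc k)) → (i j : ℤ) → Fraction
ψ k zero i j = X i j
ψ k (suc t) i j with view t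
ψ k (suc .(fromℕ k)) i j | ‵fromℕ = X i j
ψ (suc zero) (suc .(inject₁ zero)) i j | ‵inject₁ zero =
  (X (i ℤ.- 1ℤ) j · X (i ℤ.+ 1ℤ) j ⊕ X i (j ℤ.- 1ℤ) · X i (j ℤ.+ 1ℤ)) ÷ X i j
ψ (suc (suc k)) (suc .(inject₁ t)) i j | ‵inject₁ t =
  (ψ (suc k) (suc t) (i ℤ.- 1ℤ) j · ψ (suc k) (inject₁ t) (i ℤ.+ 1ℤ) j
    ⊕ ψ (suc k) (inject₁ t) i (j ℤ.- 1ℤ) · ψ (suc k) (suc t) i (j ℤ.+ 1ℤ))
  ÷ ψ k t i j

{-# OPTIONS --safe #-}

-- On the slice a - b + i - j = c, with r = i - b, the equation reads
--   h(a+1,b+1,r) h(a,b,r+1) = h(a+1,b,r) h(a,b+1,r+1) + h(a,b+1,r) h(a+1,b,r+1),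
-- which up to signs is the Desnanot–Jacobi identity for Casoratians at r of functions
-- G_b, …, G_1, F_a, …, F_1 of r ∈ ℤ.  The values at b = 0 and at a = 0 prescribe the
-- Casoratians of F_a, …, F_1 and of G_b, …, G_1.  As these are units (monomials), such
-- F and G exist over the Laurent polynomials, by repeated antidifferences, and hence so
-- does h.  The denominators of ψ are nonzero because they are positive at x = 1.

module Submission where

open import Algebra.Bundles using (CommutativeRing)
open import Data.Empty using (⊥-elim)
open import Data.Fin.Base using (Fin; zero; suc; toℕ; fromℕ; inject₁)
import Data.Fin.Properties as Fin
open import Data.Fin.Relation.Unary.Top using (view; ‵fromℕ; ‵inject₁)
open import Data.Integer.Base as ℤ using (ℤ; +_; -[1+_]; 1ℤ)
import Data.Integer.Properties as ℤ
open import Data.Integer.Tactic.RingSolver using (solve-∀)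
open import Data.List.Base using (List; []; _∷_; _++_; length)
open import Data.List.Membership.Propositional using (_∈_)
open import Data.List.Properties using (++-identityʳ)
open import Data.List.Relation.Unary.Any using (here; there)
open import Data.Nat.Base as ℕ using (ℕ; zero; suc; _∸_)
import Data.Nat.Properties as ℕ
open import Data.Product.Base using (_×_; _,_; Σ-syntax; ∃-syntax; proj₁; proj₂)
import Level
open import Relation.Binary.PropositionalEquality.Core as ≡ using (_≡_)

-- Ring solving over an arbitrary commutative ring, with integer coefficients

module IntegerCoefficientSolver {c ℓ} (R : CommutativeRing c ℓ) where

  open CommutativeRing R
  open import Algebra.Properties.Semiring.Mult semiring
    using (×-homo-+; ×-homo-1; ×1-homo-*) renaming (_×_ to _ₙ×_)
  open import Algebra.Properties.Ring ring
    using (-‿distribˡ-*; -‿distribʳ-*; -0#≈0#; -‿involutive)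
  open import Algebra.Properties.AbelianGroup +-abelianGroup using (⁻¹-∙-comm; xyx⁻¹≈y)
  open import Algebra.Solver.Ring.AlmostCommutativeRing
    using (fromCommutativeRing; _-Raw-AlmostCommutative⟶_)
  open import Data.Maybe.Base as Maybe using (Maybe)
  open import Relation.Nullary.Decidable using (dec⇒maybe)
  open import Relation.Binary.Reasoning.Setoid setoid

  ⟦_⟧ : ℤ → Carrier
  ⟦ + n ⟧ = n ₙ× 1#
  ⟦ -[1+ n ] ⟧ = - (suc n ₙ× 1#)

  ⟦⟧-⊖ : ∀ m n → ⟦ m ℤ.⊖ n ⟧ ≈ m ₙ× 1# + - (n ₙ× 1#)
  ⟦⟧-⊖ zero zero = sym (-‿inverseʳ 0#)
  ⟦⟧-⊖ zero (suc n) = sym (+-identityˡ _)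
  ⟦⟧-⊖ (suc m) zero = sym (trans (+-congˡ -0#≈0#) (+-identityʳ _))
  ⟦⟧-⊖ (suc m) (suc n) = begin
    ⟦ suc m ℤ.⊖ suc n ⟧ ≡⟨ ≡.cong ⟦_⟧ (ℤ.[1+m]⊖[1+n]≡m⊖n m n) ⟩
    ⟦ m ℤ.⊖ n ⟧         ≈⟨ ⟦⟧-⊖ m n ⟩
    M + - N             ≈⟨ +-congʳ (xyx⁻¹≈y 1# M) ⟨
    1# + M + - 1# + - N   ≈⟨ +-assoc _ _ _ ⟩
    1# + M + (- 1# + - N) ≈⟨ +-congˡ (⁻¹-∙-comm 1# N) ⟩
    1# + M + - (1# + N)   ∎
    where
    M = m ₙ× 1#
    N = n ₙ× 1#

  ⟦⟧-homo-+ : ∀ i j → ⟦ i ℤ.+ j ⟧ ≈ ⟦ i ⟧ + ⟦ j ⟧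
  ⟦⟧-homo-+ (+ m) (+ n) = ×-homo-+ 1# m n
  ⟦⟧-homo-+ (+ m) -[1+ n ] = ⟦⟧-⊖ m (suc n)
  ⟦⟧-homo-+ -[1+ m ] (+ n) = trans (⟦⟧-⊖ n (suc m)) (+-comm _ _)
  ⟦⟧-homo-+ -[1+ m ] -[1+ n ] = begin
    - (suc (suc (m ℕ.+ n)) ₙ× 1#)       ≡⟨ ≡.cong (λ k → - (suc k ₙ× 1#)) (ℕ.+-suc m n) ⟨
    - ((suc m ℕ.+ suc n) ₙ× 1#)         ≈⟨ -‿cong (×-homo-+ 1# (suc m) (suc n)) ⟩
    - (suc m ₙ× 1# + suc n ₙ× 1#)       ≈⟨ ⁻¹-∙-comm _ _ ⟨
    - (suc m ₙ× 1#) + - (suc n ₙ× 1#)   ∎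

  ⟦⟧-homo-neg : ∀ i → ⟦ ℤ.- i ⟧ ≈ - ⟦ i ⟧
  ⟦⟧-homo-neg (+ zero) = sym -0#≈0#
  ⟦⟧-homo-neg (+ suc n) = refl
  ⟦⟧-homo-neg -[1+ n ] = sym (-‿involutive _)

  ⟦⟧-homo-pos-*-pos : ∀ m n → ⟦ + m ℤ.* + n ⟧ ≈ ⟦ + m ⟧ * ⟦ + n ⟧
  ⟦⟧-homo-pos-*-pos m n = trans (reflexive (≡.cong ⟦_⟧ (≡.sym (ℤ.pos-* m n)))) (×1-homo-* m n)

  ⟦⟧-homo-pos-* : ∀ m j → ⟦ + m ℤ.* j ⟧ ≈ ⟦ + m ⟧ * ⟦ j ⟧
  ⟦⟧-homo-pos-* m (+ n) = ⟦⟧-homo-pos-*-pos m n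
  ⟦⟧-homo-pos-* m -[1+ n ] = begin
    ⟦ + m ℤ.* -[1+ n ] ⟧        ≡⟨ ≡.cong ⟦_⟧ (ℤ.neg-distribʳ-* (+ m) (+ suc n)) ⟨
    ⟦ ℤ.- (+ m ℤ.* + suc n) ⟧   ≈⟨ ⟦⟧-homo-neg (+ m ℤ.* + suc n) ⟩
    - ⟦ + m ℤ.* + suc n ⟧       ≈⟨ -‿cong (⟦⟧-homo-pos-*-pos m (suc n)) ⟩
    - (⟦ + m ⟧ * ⟦ + suc n ⟧)   ≈⟨ -‿distribʳ-* _ _ ⟩
    ⟦ + m ⟧ * - ⟦ + suc n ⟧     ∎

  ⟦⟧-homo-* : ∀ i j → ⟦ i ℤ.* j ⟧ ≈ ⟦ i ⟧ * ⟦ j ⟧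
  ⟦⟧-homo-* (+ m) j = ⟦⟧-homo-pos-* m j
  ⟦⟧-homo-* -[1+ m ] j = begin
    ⟦ -[1+ m ] ℤ.* j ⟧          ≡⟨ ≡.cong ⟦_⟧ (ℤ.neg-distribˡ-* (+ suc m) j) ⟨
    ⟦ ℤ.- (+ suc m ℤ.* j) ⟧     ≈⟨ ⟦⟧-homo-neg (+ suc m ℤ.* j) ⟩
    - ⟦ + suc m ℤ.* j ⟧         ≈⟨ -‿cong (⟦⟧-homo-pos-* (suc m) j) ⟩
    - (⟦ + suc m ⟧ * ⟦ j ⟧)     ≈⟨ -‿distribˡ-* _ _ ⟩
    - ⟦ + suc m ⟧ * ⟦ j ⟧       ∎

  ⟦⟧-morphism : ℤ.+-*-rawRing -Raw-AlmostCommutative⟶ fromCommutativeRing R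
  ⟦⟧-morphism = record
    { ⟦_⟧ = ⟦_⟧ ; +-homo = ⟦⟧-homo-+ ; *-homo = ⟦⟧-homo-* ; -‿homo = ⟦⟧-homo-neg
    ; 0-homo = refl ; 1-homo = ×-homo-1 1# }

  -- Distinct integers may have the same image in `R`, so comparing in ℤ can confirm an equality but
  -- not refute it; that is enough to recognise cancelling coefficients.
  ⟦⟧-≟ : ∀ i j → Maybe (⟦ i ⟧ ≈ ⟦ j ⟧)
  ⟦⟧-≟ i j = Maybe.map (λ eq → reflexive (≡.cong ⟦_⟧ eq)) (dec⇒maybe (i ℤ.≟ j))

  open import Algebra.Solver.Ring ℤ.+-*-rawRing (fromCommutativeRing R) ⟦⟧-morphism ⟦⟧-≟ public
    using (solve; con; _:=_; _:+_; _:*_; _:-_; :-_)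

-- Laplace expansion, minors and the Desnanot-Jacobi identity

module Minors {c ℓ} (R : CommutativeRing c ℓ) where

  open CommutativeRing R hiding (zero)
  open IntegerCoefficientSolver R
  open import Algebra.Properties.Ring ring using (-0#≈0#; -1*x≈-x)
  open import Relation.Binary.Reasoning.Setoid setoid

  Column : Set c
  Column = ℤ → Carrier

  Form : Set c
  Form = List Column → Carrier

  at : ℤ → Column → Carrier
  at ρ v = v ρ

  -- Laplace expansion: ε L Φ vs is the alternating sum of the L vₖ * Φ (vs without vₖ).
  ε : (Column → Carrier) → Form → Form
  ε L Φ []       = 0#
  ε L Φ (v ∷ vs) = L v * Φ vs - ε L (λ us → Φ (v ∷ us)) vs

  minor : List ℤ → Form
  minor []       []      = 1#
  minor []       (_ ∷ _) = 0#
  minor (ρ ∷ ρs) vs      = ε (at ρ) (minor ρs) vs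

  -- Contraction with linear forms

  -‿cong₂ : ∀ {a a′ b b′} → a ≈ a′ → b ≈ b′ → a - b ≈ a′ - b′
  -‿cong₂ p q = +-cong p (-‿cong q)

  ε-cong : ∀ L {Φ Ψ} → (∀ us → Φ us ≈ Ψ us) → ∀ vs → ε L Φ vs ≈ ε L Ψ vs
  ε-cong L eq []       = refl
  ε-cong L eq (v ∷ vs) = -‿cong₂ (*-congˡ (eq vs)) (ε-cong L (λ us → eq (v ∷ us)) vs)

  ε-zero : ∀ L {Φ} → (∀ us → Φ us ≈ 0#) → ∀ vs → ε L Φ vs ≈ 0#
  ε-zero L     eq []       = refl
  ε-zero L {Φ} eq (v ∷ vs) = begin
    L v * Φ vs - ε L (λ us → Φ (v ∷ us)) vs
      ≈⟨ -‿cong₂ (*-congˡ (eq vs)) (ε-zero L (λ us → eq (v ∷ us)) vs) ⟩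
    L v * 0# - 0#
      ≈⟨ solve 1 (λ l → l :* con ℤ.0ℤ :- con ℤ.0ℤ := con ℤ.0ℤ) refl (L v) ⟩
    0# ∎

  -- The combination `a * Φ us - Ψ us` is the shape in which `ε M Φ (v ∷ us)` depends on `us`, with
  -- `a = M v`.
  ε-linear : ∀ L a Φ Ψ vs → ε L (λ us → a * Φ us - Ψ us) vs ≈ a * ε L Φ vs - ε L Ψ vs
  ε-linear L a Φ Ψ []       = solve 1 (λ a → con ℤ.0ℤ := a :* con ℤ.0ℤ :- con ℤ.0ℤ) refl a
  ε-linear L a Φ Ψ (v ∷ vs) = begin
    L v * (a * Φ vs - Ψ vs) - ε L (λ us → a * Φ (v ∷ us) - Ψ (v ∷ us)) vs
      ≈⟨ -‿cong₂ refl (ε-linear L a _ _ vs) ⟩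
    L v * (a * Φ vs - Ψ vs) - (a * x - y)
      ≈⟨ solve 6 (λ l a p q x y → l :* (a :* p :- q) :- (a :* x :- y)
                               := a :* (l :* p :- x) :- (l :* q :- y))
           refl (L v) a (Φ vs) (Ψ vs) x y ⟩
    a * (L v * Φ vs - x) - (L v * Ψ vs - y) ∎
    where
    x = ε L (λ us → Φ (v ∷ us)) vs
    y = ε L (λ us → Ψ (v ∷ us)) vs

  ε-scale : ∀ L a Φ vs → ε L (λ us → a * Φ us) vs ≈ a * ε L Φ vs
  ε-scale L a Φ vs = begin
    ε L (λ us → a * Φ us) vs
      ≈⟨ ε-cong L (λ us → solve 1 (λ x → x := x :- con ℤ.0ℤ) refl (a * Φ us)) vs ⟩
    ε L (λ us → a * Φ us - 0#) vs
      ≈⟨ ε-linear L a Φ _ vs ⟩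
    a * ε L Φ vs - ε L (λ _ → 0#) vs
      ≈⟨ -‿cong₂ refl (ε-zero L (λ _ → refl) vs) ⟩
    a * ε L Φ vs - 0#
      ≈⟨ solve 1 (λ x → x :- con ℤ.0ℤ := x) refl _ ⟩
    a * ε L Φ vs ∎

  ε-neg : ∀ L Φ vs → ε L (λ us → - Φ us) vs ≈ - ε L Φ vs
  ε-neg L Φ vs = begin
    ε L (λ us → - Φ us) vs       ≈⟨ ε-cong L (λ us → neg (Φ us)) vs ⟩
    ε L (λ us → - 1# * Φ us) vs  ≈⟨ ε-scale L (- 1#) Φ vs ⟩
    - 1# * ε L Φ vs              ≈⟨ neg (ε L Φ vs) ⟨
    - ε L Φ vs                   ∎
    where
    neg : ∀ x → - x ≈ - 1# * x
    neg x = sym (-1*x≈-x x)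

  ε-kernel : ∀ L Φ {vs} → (∀ {v} → v ∈ vs → L v ≈ 0#) → ε L Φ vs ≈ 0#
  ε-kernel L Φ {[]}     eq = refl
  ε-kernel L Φ {v ∷ vs} eq = begin
    L v * Φ vs - ε L (λ us → Φ (v ∷ us)) vs
      ≈⟨ -‿cong₂ (*-congʳ (eq (here ≡.refl))) (ε-kernel L _ (λ v∈vs → eq (there v∈vs))) ⟩
    0# * Φ vs - 0#
      ≈⟨ solve 1 (λ x → con ℤ.0ℤ :* x :- con ℤ.0ℤ := con ℤ.0ℤ) refl (Φ vs) ⟩
    0# ∎

  -- The terms in which exactly one of `L` and `M` consumes `v` are antisymmetric in the two forms;
  -- in the others `v` is merely carried along. This is the inductive step of both `ε-anticomm` and
  -- `ε-nilpotent`.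
  ε-ε-∷ : ∀ L M Φ v vs →
    ε L (ε M Φ) (v ∷ vs) ≈
      (L v * ε M Φ vs - M v * ε L Φ vs) + ε L (ε M (λ us → Φ (v ∷ us))) vs
  ε-ε-∷ L M Φ v vs = begin
    L v * ε M Φ vs - ε L (λ us → M v * Φ us - ε M (λ ws → Φ (v ∷ ws)) us) vs
      ≈⟨ -‿cong₂ refl (ε-linear L (M v) Φ _ vs) ⟩
    L v * ε M Φ vs - (M v * ε L Φ vs - z)
      ≈⟨ solve 3 (λ x y z → x :- (y :- z) := (x :- y) :+ z) refl
           (L v * ε M Φ vs) (M v * ε L Φ vs) z ⟩
    (L v * ε M Φ vs - M v * ε L Φ vs) + z ∎
    where z = ε L (ε M (λ us → Φ (v ∷ us))) vs

  ε-anticomm : ∀ L M Φ vs → ε L (ε M Φ) vs ≈ - ε M (ε L Φ) vs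
  ε-anticomm L M Φ []       = sym -0#≈0#
  ε-anticomm L M Φ (v ∷ vs) = begin
    ε L (ε M Φ) (v ∷ vs)
      ≈⟨ ε-ε-∷ L M Φ v vs ⟩
    (x - y) + ε L (ε M (λ us → Φ (v ∷ us))) vs
      ≈⟨ +-congˡ (ε-anticomm L M _ vs) ⟩
    (x - y) + - z
      ≈⟨ solve 3 (λ x y z → (x :- y) :+ :- z := :- ((y :- x) :+ z)) refl x y z ⟩
    - ((y - x) + z)
      ≈⟨ -‿cong (ε-ε-∷ M L Φ v vs) ⟨
    - ε M (ε L Φ) (v ∷ vs) ∎
    where
    x = L v * ε M Φ vs
    y = M v * ε L Φ vs
    z = ε M (ε L (λ us → Φ (v ∷ us))) vs

  -- Taking `M = L` in `ε-anticomm` only shows that twice the value is 0, and 2 need not be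
  -- cancellable in `R`; hence a separate induction.
  ε-nilpotent : ∀ L Φ vs → ε L (ε L Φ) vs ≈ 0#
  ε-nilpotent L Φ []       = refl
  ε-nilpotent L Φ (v ∷ vs) = begin
    ε L (ε L Φ) (v ∷ vs)
      ≈⟨ ε-ε-∷ L L Φ v vs ⟩
    (L v * ε L Φ vs - L v * ε L Φ vs) + ε L (ε L (λ us → Φ (v ∷ us))) vs
      ≈⟨ +-cong (-‿inverseʳ _) (ε-nilpotent L _ vs) ⟩
    0# + 0#
      ≈⟨ +-identityˡ 0# ⟩
    0# ∎

  -- Minors as alternating multilinear functions of their columns

  record Alternating (Φ : Form) : Set (c Level.⊔ ℓ) where
    field
      swap   : ∀ us v w vs → Φ (us ++ v ∷ w ∷ vs) ≈ - Φ (us ++ w ∷ v ∷ vs)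
      -- Demanded separately, as `swap` with equal columns only makes twice the value 0.
      double : ∀ us v vs → Φ (us ++ v ∷ v ∷ vs) ≈ 0#

  open Alternating

  alternating-∷ : ∀ {Φ} → Alternating Φ → ∀ u → Alternating (λ us → Φ (u ∷ us))
  alternating-∷ alt u = record
    { swap   = λ us → swap alt (u ∷ us)
    ; double = λ us → double alt (u ∷ us) }

  ε-swap : ∀ L {Φ} → Alternating Φ →
    ∀ us v w vs → ε L Φ (us ++ v ∷ w ∷ vs) ≈ - ε L Φ (us ++ w ∷ v ∷ vs)
  ε-swap L {Φ} alt [] v w vs = begin
    L v * Φ (w ∷ vs) - (L w * Φ (v ∷ vs) - ε L (λ us → Φ (v ∷ w ∷ us)) vs)
      ≈⟨ -‿cong₂ refl (-‿cong₂ refl (ε-cong L (λ us → swap alt [] v w us) vs)) ⟩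
    L v * Φ (w ∷ vs) - (L w * Φ (v ∷ vs) - ε L (λ us → - Φ (w ∷ v ∷ us)) vs)
      ≈⟨ -‿cong₂ refl (-‿cong₂ refl (ε-neg L _ vs)) ⟩
    L v * Φ (w ∷ vs) - (L w * Φ (v ∷ vs) - - z)
      ≈⟨ solve 3 (λ x y z → x :- (y :- (:- z)) := :- (y :- (x :- z))) refl
           (L v * Φ (w ∷ vs)) (L w * Φ (v ∷ vs)) z ⟩
    - (L w * Φ (v ∷ vs) - (L v * Φ (w ∷ vs) - z)) ∎
    where z = ε L (λ us → Φ (w ∷ v ∷ us)) vs
  ε-swap L {Φ} alt (u ∷ us) v w vs = begin
    L u * Φ (us ++ v ∷ w ∷ vs) - ε L (λ us → Φ (u ∷ us)) (us ++ v ∷ w ∷ vs)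
      ≈⟨ -‿cong₂ (*-congˡ (swap alt us v w vs)) (ε-swap L (alternating-∷ alt u) us v w vs) ⟩
    L u * - Φ (us ++ w ∷ v ∷ vs) - - z
      ≈⟨ solve 3 (λ l x z → l :* :- x :- (:- z) := :- (l :* x :- z)) refl
           (L u) (Φ (us ++ w ∷ v ∷ vs)) z ⟩
    - (L u * Φ (us ++ w ∷ v ∷ vs) - z) ∎
    where z = ε L (λ us → Φ (u ∷ us)) (us ++ w ∷ v ∷ vs)

  ε-double : ∀ L {Φ} → Alternating Φ → ∀ us v vs → ε L Φ (us ++ v ∷ v ∷ vs) ≈ 0#
  ε-double L {Φ} alt [] v vs = begin
    x - (x - ε L (λ us → Φ (v ∷ v ∷ us)) vs)
      ≈⟨ -‿cong₂ refl (-‿cong₂ refl (ε-zero L (λ us → double alt [] v us) vs)) ⟩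
    x - (x - 0#)
      ≈⟨ solve 1 (λ x → x :- (x :- con ℤ.0ℤ) := con ℤ.0ℤ) refl x ⟩
    0# ∎
    where x = L v * Φ (v ∷ vs)
  ε-double L {Φ} alt (u ∷ us) v vs = begin
    L u * Φ (us ++ v ∷ v ∷ vs) - ε L (λ us → Φ (u ∷ us)) (us ++ v ∷ v ∷ vs)
      ≈⟨ -‿cong₂ (*-congˡ (double alt us v vs)) (ε-double L (alternating-∷ alt u) us v vs) ⟩
    L u * 0# - 0#
      ≈⟨ solve 1 (λ l → l :* con ℤ.0ℤ :- con ℤ.0ℤ := con ℤ.0ℤ) refl (L u) ⟩
    0# ∎

  minor-alternating : ∀ ρs → Alternating (minor ρs)
  minor-alternating [] = record
    { swap   = λ { [] _ _ _ → sym -0#≈0# ; (_ ∷ _) _ _ _ → sym -0#≈0# }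
    ; double = λ { [] _ _ → refl ; (_ ∷ _) _ _ → refl } }
  minor-alternating (ρ ∷ ρs) = record
    { swap   = ε-swap (at ρ) (minor-alternating ρs)
    ; double = ε-double (at ρ) (minor-alternating ρs) }

  alternating-repeat : ∀ {Φ} → Alternating Φ → ∀ {v vs} → v ∈ vs → Φ (v ∷ vs) ≈ 0#
  alternating-repeat     alt {v} {_ ∷ vs} (here ≡.refl) = double alt [] v vs
  alternating-repeat {Φ} alt {v} {w ∷ vs} (there v∈vs)  = begin
    Φ (v ∷ w ∷ vs)    ≈⟨ swap alt [] v w vs ⟩
    - Φ (w ∷ v ∷ vs)  ≈⟨ -‿cong (alternating-repeat (alternating-∷ alt w) v∈vs) ⟩
    - 0#              ≈⟨ -0#≈0# ⟩
    0#                ∎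

  sgn : ℕ → Carrier
  sgn zero    = 1#
  sgn (suc n) = - sgn n

  -- Moving `v` past `us` takes one `swap` for each element of `us`.
  alternating-insert : ∀ {Φ} → Alternating Φ → ∀ us v vs →
    Φ (v ∷ us ++ vs) ≈ sgn (length us) * Φ (us ++ v ∷ vs)
  alternating-insert     alt []       v vs = sym (*-identityˡ _)
  alternating-insert {Φ} alt (u ∷ us) v vs = begin
    Φ (v ∷ u ∷ us ++ vs)
      ≈⟨ swap alt [] v u (us ++ vs) ⟩
    - Φ (u ∷ v ∷ us ++ vs)
      ≈⟨ -‿cong (alternating-insert (alternating-∷ alt u) us v vs) ⟩
    - (sgn (length us) * Φ (u ∷ us ++ v ∷ vs))
      ≈⟨ solve 2 (λ s x → :- (s :* x) := :- s :* x) refl _ _ ⟩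
    - sgn (length us) * Φ (u ∷ us ++ v ∷ vs) ∎

  minor-zero : ∀ ρs {v} → (∀ {ρ} → ρ ∈ ρs → v ρ ≈ 0#) → ∀ us → minor ρs (v ∷ us) ≈ 0#
  minor-zero []           eq us = refl
  minor-zero (ρ ∷ ρs) {v} eq us = begin
    v ρ * minor ρs us - ε (at ρ) (λ us → minor ρs (v ∷ us)) us
      ≈⟨ -‿cong₂ (*-congʳ (eq (here ≡.refl)))
                 (ε-zero (at ρ) (minor-zero ρs (λ ρ∈ρs → eq (there ρ∈ρs))) us) ⟩
    0# * minor ρs us - 0#
      ≈⟨ solve 1 (λ x → con ℤ.0ℤ :* x :- con ℤ.0ℤ := con ℤ.0ℤ) refl _ ⟩
    0# ∎

  -- A Laplace expansion, read as a function of its row, has the form `v ρ * a - w ρ`; this is the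
  -- inductive step of `minor-ε`.
  minor-linear : ∀ ρs a v w us →
    minor ρs ((λ ρ → v ρ * a - w ρ) ∷ us) ≈ minor ρs (v ∷ us) * a - minor ρs (w ∷ us)
  minor-linear []       a v w us = solve 1 (λ a → con ℤ.0ℤ := con ℤ.0ℤ :* a :- con ℤ.0ℤ) refl a
  minor-linear (ρ ∷ ρs) a v w us = begin
    (v ρ * a - w ρ) * Φ us - ε (at ρ) (λ us → Φ ((λ ρ → v ρ * a - w ρ) ∷ us)) us
      ≈⟨ -‿cong₂ refl (ε-cong (at ρ) (λ us → trans (minor-linear ρs a v w us)
                                                   (-‿cong₂ (*-comm _ a) refl)) us) ⟩
    (v ρ * a - w ρ) * Φ us - ε (at ρ) (λ us → a * Φ (v ∷ us) - Φ (w ∷ us)) us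
      ≈⟨ -‿cong₂ refl (ε-linear (at ρ) a _ _ us) ⟩
    (v ρ * a - w ρ) * Φ us - (a * x - y)
      ≈⟨ solve 6 (λ p q a f x y → (p :* a :- q) :* f :- (a :* x :- y)
                               := (p :* f :- x) :* a :- (q :* f :- y)) refl
           (v ρ) (w ρ) a (Φ us) x y ⟩
    (v ρ * Φ us - x) * a - (w ρ * Φ us - y) ∎
    where
    Φ = minor ρs
    x = ε (at ρ) (λ us → Φ (v ∷ us)) us
    y = ε (at ρ) (λ us → Φ (w ∷ us)) us

  -- The first column on the left is a linear combination of the `vs` whose coefficients do not
  -- depend on `ρ`, so linearity moves the minor inside the expansion.
  minor-ε : ∀ ρs us Φ vs →
    minor ρs ((λ ρ → ε (at ρ) Φ vs) ∷ us) ≈ ε (λ v → minor ρs (v ∷ us)) Φ vs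
  minor-ε ρs us Φ []       = minor-zero ρs (λ _ → refl) us
  minor-ε ρs us Φ (v ∷ vs) =
    trans (minor-linear ρs (Φ vs) v _ us) (-‿cong₂ refl (minor-ε ρs us _ vs))

  -- A determinant with a repeated row: anticommutation brings the new row next to its twin, where
  -- nilpotency applies.
  ε-row : ∀ ρs {ρ} → ρ ∈ ρs → ∀ vs → ε (at ρ) (minor ρs) vs ≈ 0#
  ε-row (ρ ∷ ρs)      (here ≡.refl) vs = ε-nilpotent (at ρ) (minor ρs) vs
  ε-row (σ ∷ ρs) {ρ} (there ρ∈ρs)  vs = begin
    ε (at ρ) (ε (at σ) (minor ρs)) vs    ≈⟨ ε-anticomm (at ρ) (at σ) (minor ρs) vs ⟩
    - ε (at σ) (ε (at ρ) (minor ρs)) vs  ≈⟨ -‿cong (ε-zero (at σ) (ε-row ρs ρ∈ρs) vs) ⟩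
    - 0#                                 ≈⟨ -0#≈0# ⟩
    0#                                   ∎

  -- Both sides evaluate the minor with rows ρ, σ, ρs at the columns h, w, vs, where
  -- h = Φ(vs) v - (a combination of the vs) has entries ε (at τ) Φ (v ∷ vs), τ ∈ ℤ:
  -- these vanish at the rows ρs, and the columns vs are already present.
  desnanot-jacobi : ∀ ρ σ ρs v w vs →
    minor (ρ ∷ σ ∷ ρs) (v ∷ w ∷ vs) * minor ρs vs ≈
      minor (ρ ∷ ρs) (v ∷ vs) * minor (σ ∷ ρs) (w ∷ vs) -
      minor (σ ∷ ρs) (v ∷ vs) * minor (ρ ∷ ρs) (w ∷ vs)
  desnanot-jacobi ρ σ ρs v w vs = begin
    L v * Φ vs
      ≈⟨ solve 1 (λ x → x := x :- con ℤ.0ℤ) refl _ ⟩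
    L v * Φ vs - 0#
      ≈⟨ -‿cong₂ refl (ε-kernel L (λ us → Φ (v ∷ us))
           (λ u∈vs → alternating-repeat (minor-alternating (ρ ∷ σ ∷ ρs)) (there u∈vs))) ⟨
    ε L Φ (v ∷ vs)
      ≈⟨ minor-ε (ρ ∷ σ ∷ ρs) (w ∷ vs) Φ (v ∷ vs) ⟨
    minor (ρ ∷ σ ∷ ρs) (h ∷ w ∷ vs)
      ≈⟨ ε-ε-∷ (at ρ) (at σ) Φ h (w ∷ vs) ⟩
    (h ρ * minor (σ ∷ ρs) (w ∷ vs) - h σ * minor (ρ ∷ ρs) (w ∷ vs)) +
      ε (at ρ) (ε (at σ) (λ us → Φ (h ∷ us))) (w ∷ vs)
      ≈⟨ +-congˡ (ε-zero (at ρ) (ε-zero (at σ) (minor-zero ρs h-zero)) (w ∷ vs)) ⟩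
    (h ρ * minor (σ ∷ ρs) (w ∷ vs) - h σ * minor (ρ ∷ ρs) (w ∷ vs)) + 0#
      ≈⟨ +-identityʳ _ ⟩
    h ρ * minor (σ ∷ ρs) (w ∷ vs) - h σ * minor (ρ ∷ ρs) (w ∷ vs) ∎
    where
    Φ = minor ρs
    L : Column → Carrier
    L u = minor (ρ ∷ σ ∷ ρs) (u ∷ w ∷ vs)
    h : Column
    h τ = ε (at τ) Φ (v ∷ vs)
    h-zero : ∀ {τ} → τ ∈ ρs → h τ ≈ 0#
    h-zero τ∈ρs = ε-row ρs τ∈ρs (v ∷ vs)

-- Casoratians: minors on consecutive rows

module Casoratians {c ℓ} (R : CommutativeRing c ℓ) where

  open CommutativeRing R hiding (zero)
  open IntegerCoefficientSolver R
  open Minors R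
  open import Algebra.Properties.Ring ring using (-‿involutive)
  open import Relation.Binary.Reasoning.Setoid setoid

  rows : ℕ → ℤ → List ℤ
  rows zero    r = []
  rows (suc n) r = r ∷ rows n (ℤ.suc r)

  -- This is r + n, by a recursion that makes `end (suc n) r` and `end n (ℤ.suc r)` definitionally
  -- equal.
  end : ℕ → ℤ → ℤ
  end zero    r = r
  end (suc n) r = end n (ℤ.suc r)

  casoratian : ℕ → ℤ → Form
  casoratian n r = minor (rows n r)

  -- `desnanot-jacobi` has both distinguished rows on top, so the last row is moved up past the n
  -- others, with one sign per anticommutation.
  casoratian-end : ∀ n r vs →
    casoratian (suc n) r vs ≈ sgn n * minor (end n r ∷ rows n r) vs
  casoratian-end zero    r vs = sym (*-identityˡ _)
  casoratian-end (suc n) r vs = begin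
    ε (at r) (casoratian (suc n) (ℤ.suc r)) vs
      ≈⟨ ε-cong (at r) (casoratian-end n (ℤ.suc r)) vs ⟩
    ε (at r) (λ us → sgn n * ε (at e) Φ us) vs
      ≈⟨ ε-scale (at r) (sgn n) (ε (at e) Φ) vs ⟩
    sgn n * ε (at r) (ε (at e) Φ) vs
      ≈⟨ *-congˡ (ε-anticomm (at r) (at e) Φ vs) ⟩
    sgn n * - ε (at e) (ε (at r) Φ) vs
      ≈⟨ solve 2 (λ s x → s :* :- x := :- s :* x) refl _ _ ⟩
    - sgn n * ε (at e) (ε (at r) Φ) vs ∎
    where
    e = end n (ℤ.suc r)
    Φ = casoratian n (ℤ.suc r)

  -- `desnanot-jacobi` for the first and the last of n + 2 consecutive rows. Each product contains
  -- exactly one minor whose last row has to be moved up, so the same sign `sgn n` occurs on both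
  -- sides.
  casoratian-jacobi : ∀ n r v w vs →
    casoratian (2 ℕ.+ n) r (v ∷ w ∷ vs) * casoratian n (ℤ.suc r) vs ≈
      casoratian (suc n) r (v ∷ vs) * casoratian (suc n) (ℤ.suc r) (w ∷ vs) -
      casoratian (suc n) (ℤ.suc r) (v ∷ vs) * casoratian (suc n) r (w ∷ vs)
  casoratian-jacobi n r v w vs = begin
    casoratian (2 ℕ.+ n) r (v ∷ w ∷ vs) * minor ρs vs
      ≈⟨ *-congʳ (trans (ε-cong (at r) (casoratian-end n r′) (v ∷ w ∷ vs))
                        (ε-scale (at r) (sgn n) (minor (e ∷ ρs)) (v ∷ w ∷ vs))) ⟩
    sgn n * minor (r ∷ e ∷ ρs) (v ∷ w ∷ vs) * minor ρs vs
      ≈⟨ trans (*-assoc _ _ _) (*-congˡ (desnanot-jacobi r e ρs v w vs)) ⟩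
    sgn n * (minor (r ∷ ρs) (v ∷ vs) * minor (e ∷ ρs) (w ∷ vs) -
             minor (e ∷ ρs) (v ∷ vs) * minor (r ∷ ρs) (w ∷ vs))
      ≈⟨ solve 5 (λ s a b c d → s :* (a :* b :- c :* d) := a :* (s :* b) :- s :* c :* d) refl
           _ _ _ _ _ ⟩
    minor (r ∷ ρs) (v ∷ vs) * (sgn n * minor (e ∷ ρs) (w ∷ vs)) -
      sgn n * minor (e ∷ ρs) (v ∷ vs) * minor (r ∷ ρs) (w ∷ vs)
      ≈⟨ -‿cong₂ (*-congˡ (casoratian-end n r′ (w ∷ vs)))
                 (*-congʳ (casoratian-end n r′ (v ∷ vs))) ⟨
    casoratian (suc n) r (v ∷ vs) * casoratian (suc n) r′ (w ∷ vs) -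
      casoratian (suc n) r′ (v ∷ vs) * casoratian (suc n) r (w ∷ vs) ∎
    where
    r′ = ℤ.suc r
    ρs = rows n r′
    e = end n r′

  -- Columns with prescribed invertible Casoratians

  Invertible : Carrier → Set (c Level.⊔ ℓ)
  Invertible a = ∃[ b ] a * b ≈ 1#

  Invertible-cong : ∀ {a b} → a ≈ b → Invertible b → Invertible a
  Invertible-cong a≈b (b⁻¹ , bb⁻¹≈1) = b⁻¹ , trans (*-congʳ a≈b) bb⁻¹≈1

  Invertible-* : ∀ {a b} → Invertible a → Invertible b → Invertible (a * b)
  Invertible-* {a} {b} (a⁻¹ , p) (b⁻¹ , q) = a⁻¹ * b⁻¹ , (begin
    a * b * (a⁻¹ * b⁻¹)
      ≈⟨ solve 4 (λ a b a⁻¹ b⁻¹ → a :* b :* (a⁻¹ :* b⁻¹) := a :* a⁻¹ :* (b :* b⁻¹)) refl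
           a b a⁻¹ b⁻¹ ⟩
    a * a⁻¹ * (b * b⁻¹)  ≈⟨ *-cong p q ⟩
    1# * 1#              ≈⟨ *-identityˡ 1# ⟩
    1#                   ∎)

  Invertible-inverse : ∀ {a} (a⁻¹ : Invertible a) → Invertible (proj₁ a⁻¹)
  Invertible-inverse {a} (b , ab≈1) = a , trans (*-comm b a) ab≈1

  cancelʳ : ∀ {a b u} → Invertible u → a * u ≈ b * u → a ≈ b
  cancelʳ {a} {b} {u} (u⁻¹ , uu⁻¹≈1) eq = begin
    a              ≈⟨ unfold a ⟩
    a * u * u⁻¹    ≈⟨ *-congʳ eq ⟩
    b * u * u⁻¹    ≈⟨ unfold b ⟨
    b              ∎
    where
    unfold : ∀ x → x ≈ x * u * u⁻¹
    unfold x = sym (trans (*-assoc x u u⁻¹) (trans (*-congˡ uu⁻¹≈1) (*-identityʳ x)))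

  -- The condition covers every nonempty suffix because `prescribe` recurses on the tail and divides
  -- by Casoratians at each stage.
  data Regular : ℕ → List Column → Set (c Level.⊔ ℓ) where
    []  : Regular zero []
    _∷_ : ∀ {n v vs} → (∀ r → Invertible (casoratian (suc n) r (v ∷ vs))) →
          Regular n vs → Regular (suc n) (v ∷ vs)

  regular⇒invertible : ∀ {n vs} → Regular n vs → ∀ r → Invertible (casoratian n r vs)
  regular⇒invertible []          r = 1# , *-identityˡ 1#
  regular⇒invertible (units ∷ _) r = units r

  -- Summation in both directions from y 0 = 0, which is possible over any commutative ring.
  antidifference : (g : ℤ → Carrier) → ∃[ y ] ∀ r → y r - y (ℤ.suc r) ≈ g r
  antidifference g = y , y-difference
    where
    y : ℤ → Carrier
    y (+ zero)       = 0#
    y (+ suc n)      = y (+ n) - g (+ n)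
    y -[1+ zero ]    = 0# + g -[1+ zero ]
    y -[1+ suc n ]   = y -[1+ n ] + g -[1+ suc n ]

    y-difference : ∀ r → y r - y (ℤ.suc r) ≈ g r
    y-difference (+ n) = solve 2 (λ a b → a :- (a :- b) := b) refl (y (+ n)) (g (+ n))
    y-difference -[1+ zero ] = solve 2 (λ a b → a :+ b :- a := b) refl 0# (g -[1+ zero ])
    y-difference -[1+ suc n ] =
      solve 2 (λ a b → a :+ b :- a := b) refl (y -[1+ n ]) (g -[1+ suc n ])

  -- If the Casoratian of (u, vs) is y times that of (v, vs), then the Desnanot–Jacobi
  -- identity expresses the Casoratian of (u, v, vs) by the difference of y.
  prescribe : ∀ {n vs} → Regular n vs → (φ : ℤ → Carrier) →
    ∃[ u ] ∀ r → casoratian (suc n) r (u ∷ vs) ≈ φ r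
  prescribe [] φ = φ , λ r → begin
    φ r * 1# - 0#  ≈⟨ -‿cong₂ (*-identityʳ (φ r)) refl ⟩
    φ r - 0#       ≈⟨ solve 1 (λ a → a :- con ℤ.0ℤ := a) refl (φ r) ⟩
    φ r            ∎
  prescribe {suc n} {v ∷ vs} (units ∷ reg) φ = u , λ r →
    let r′ = ℤ.suc r in
    cancelʳ (regular⇒invertible reg r′) (begin
      casoratian (2 ℕ.+ n) r (u ∷ v ∷ vs) * casoratian n r′ vs
        ≈⟨ casoratian-jacobi n r u v vs ⟩
      casoratian (suc n) r (u ∷ vs) * ω r′ - casoratian (suc n) r′ (u ∷ vs) * ω r
        ≈⟨ -‿cong₂ (*-congʳ (u-spec r)) (*-congʳ (u-spec r′)) ⟩
      y r * ω r * ω r′ - y r′ * ω r′ * ω r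
        ≈⟨ solve 4 (λ a b p q → a :* p :* q :- b :* q :* p := (a :- b) :* (p :* q)) refl
             (y r) (y r′) (ω r) (ω r′) ⟩
      (y r - y r′) * (ω r * ω r′)
        ≈⟨ *-congʳ (y-spec r) ⟩
      φ r * casoratian n r′ vs * (ω⁻¹ r * ω⁻¹ r′) * (ω r * ω r′)
        ≈⟨ solve 5 (λ f p q p⁻¹ q⁻¹ → f :* (p⁻¹ :* q⁻¹) :* (p :* q)
                                   := f :* ((p :* p⁻¹) :* (q :* q⁻¹))) refl
             _ (ω r) (ω r′) (ω⁻¹ r) (ω⁻¹ r′) ⟩
      φ r * casoratian n r′ vs * ((ω r * ω⁻¹ r) * (ω r′ * ω⁻¹ r′))
        ≈⟨ *-congˡ (trans (*-cong (proj₂ (units r)) (proj₂ (units r′))) (*-identityˡ 1#)) ⟩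
      φ r * casoratian n r′ vs * 1#
        ≈⟨ *-identityʳ _ ⟩
      φ r * casoratian n r′ vs ∎)
    where
    ω ω⁻¹ : ℤ → Carrier
    ω r = casoratian (suc n) r (v ∷ vs)
    ω⁻¹ r = proj₁ (units r)

    -- `casoratian-jacobi` solved for the difference of y: the prescribed value times the Casoratian
    -- of `vs`, divided by `ω` at r and r + 1.
    y-exists : ∃[ y ] ∀ r → y r - y (ℤ.suc r) ≈
      φ r * casoratian n (ℤ.suc r) vs * (ω⁻¹ r * ω⁻¹ (ℤ.suc r))
    y-exists = antidifference _
    y = proj₁ y-exists
    y-spec = proj₂ y-exists

    u-exists : ∃[ u ] ∀ r → casoratian (suc n) r (u ∷ vs) ≈ y r * ω r
    u-exists = prescribe reg (λ r → y r * ω r)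
    u = proj₁ u-exists
    u-spec = proj₂ u-exists

  module Columns (φ : ℕ → ℤ → Carrier) (φ-invertible : ∀ n r → Invertible (φ n r)) where

    regular : ∀ n → ∃[ vs ] Regular n vs
    regular zero    = [] , []
    regular (suc n) =
      let vs , reg = regular n
          v , spec = prescribe reg (φ n)
      in v ∷ vs , (λ r → Invertible-cong (spec r) (φ-invertible n r)) ∷ reg

    -- `columns (suc n)` unfolds to `column n ∷ columns n`: earlier columns are never changed, so a
    -- single sequence of functions realises all the `φ n`.
    column : ℕ → Column
    column n = proj₁ (prescribe (proj₂ (regular n)) (φ n))

    columns : ℕ → List Column
    columns n = proj₁ (regular n)

    casoratian-columns : ∀ n r → casoratian (suc n) r (columns (suc n)) ≈ φ n r
    casoratian-columns n = proj₂ (prescribe (proj₂ (regular n)) (φ n))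

  -- Solutions on one slice with prescribed values `α` at b = 0 and `β` at a = 0

  module HirotaMiwa
    (α β : ℕ → ℤ → Carrier)
    (α-invertible : ∀ a r → Invertible (α a r))
    (β-invertible : ∀ b r → Invertible (β b r))
    (α₀≈β₀ : ∀ r → α 0 r ≈ β 0 r)
    where

    sgn-square : ∀ n → sgn n * sgn n ≈ 1#
    sgn-square zero    = *-identityˡ 1#
    sgn-square (suc n) = trans (solve 1 (λ s → :- s :* :- s := s :* s) refl (sgn n)) (sgn-square n)

    -- The sign τ(r)^b turns the difference in the Casoratian identity into a sum, and the
    -- factor Λ replaces the empty Casoratian 1 by the required values α 0 at a = b = 0.
    τ : ℤ → Carrier
    τ (+ n)    = sgn n
    τ -[1+ n ] = sgn (suc n)

    τ-suc : ∀ r → τ (ℤ.suc r) ≈ - τ r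
    τ-suc (+ n)        = refl
    τ-suc -[1+ zero ]  = sym (-‿involutive _)
    τ-suc -[1+ suc n ] = sym (-‿involutive _)

    τ-square : ∀ r → τ r * τ r ≈ 1#
    τ-square (+ n)    = sgn-square n
    τ-square -[1+ n ] = sgn-square (suc n)

    τ^ : ℕ → ℤ → Carrier
    τ^ zero    r = 1#
    τ^ (suc q) r = τ r * τ^ q r

    τ^-square : ∀ q r → τ^ q r * τ^ q r ≈ 1#
    τ^-square zero    r = *-identityˡ 1#
    τ^-square (suc q) r = begin
      τ r * τ^ q r * (τ r * τ^ q r)
        ≈⟨ solve 2 (λ t s → t :* s :* (t :* s) := (t :* t) :* (s :* s)) refl (τ r) (τ^ q r) ⟩
      (τ r * τ r) * (τ^ q r * τ^ q r)
        ≈⟨ *-cong (τ-square r) (τ^-square q r) ⟩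
      1# * 1#
        ≈⟨ *-identityˡ 1# ⟩
      1# ∎

    Λ Λ⁻¹ : ℕ → ℤ → Carrier
    Λ n r = α 0 (end n r)
    Λ⁻¹ n r = proj₁ (α-invertible 0 (end n r))

    Λ-inverse : ∀ n r → Λ n r * Λ⁻¹ n r ≈ 1#
    Λ-inverse n r = proj₂ (α-invertible 0 (end n r))

    Λ⁻¹-invertible : ∀ n r → Invertible (Λ⁻¹ n r)
    Λ⁻¹-invertible n r = Invertible-inverse (α-invertible 0 (end n r))

    -- Casoratian number a has size a + 1, hence the shift in `α`; the factor `Λ⁻¹` anticipates the
    -- `Λ` in `entry`.
    module F = Columns
      (λ a r → α (suc a) r * Λ⁻¹ (suc a) r)
      (λ a r → Invertible-* (α-invertible (suc a) r) (Λ⁻¹-invertible (suc a) r))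

    -- `τ^` is its own inverse, so multiplying by it here undoes the one in `entry`.
    module G = Columns
      (λ b r → τ^ (suc b) r * β (suc b) r * Λ⁻¹ (suc b) r)
      (λ b r → Invertible-*
        (Invertible-* (τ^ (suc b) r , τ^-square (suc b) r) (β-invertible (suc b) r))
        (Λ⁻¹-invertible (suc b) r))

    entry : ℕ → ℕ → ℤ → List Column → Carrier
    entry n b r vs = Λ n r * τ^ b r * casoratian n r vs

    -- Moving the new F-column past the G-columns costs the sign σ, which cancels.
    hirota-casoratian : ∀ n r f g us vs →
      casoratian (2 ℕ.+ n) r (g ∷ us ++ f ∷ vs) * casoratian n (ℤ.suc r) (us ++ vs) ≈
        casoratian (suc n) r (g ∷ us ++ vs) * casoratian (suc n) (ℤ.suc r) (us ++ f ∷ vs) -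
        casoratian (suc n) r (us ++ f ∷ vs) * casoratian (suc n) (ℤ.suc r) (g ∷ us ++ vs)
    hirota-casoratian n r f g us vs = begin
      X * W
        ≈⟨ unit (X * W) ⟩
      σ * σ * (X * W)
        ≈⟨ solve 3 (λ s x w → s :* s :* (x :* w) := :- s :* (:- s :* x :* w)) refl σ X W ⟩
      - σ * (- σ * X * W)
        ≈⟨ *-congˡ (*-congʳ (insert (2 ℕ.+ n) r (g ∷ us))) ⟨
      - σ * (casoratian (2 ℕ.+ n) r (f ∷ g ∷ us ++ vs) * W)
        ≈⟨ *-congˡ (casoratian-jacobi n r f g (us ++ vs)) ⟩
      - σ * (casoratian (suc n) r (f ∷ us ++ vs) * Z r′ -
             casoratian (suc n) r′ (f ∷ us ++ vs) * Z r)
        ≈⟨ *-congˡ (-‿cong₂ (*-congʳ (insert (suc n) r us)) (*-congʳ (insert (suc n) r′ us))) ⟩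
      - σ * (σ * Y r * Z r′ - σ * Y r′ * Z r)
        ≈⟨ solve 5 (λ s y z y′ z′ → :- s :* (s :* y :* z′ :- s :* y′ :* z)
                                 := s :* s :* (z :* y′ :- y :* z′)) refl σ (Y r) (Z r) (Y r′) (Z r′) ⟩
      σ * σ * (Z r * Y r′ - Y r * Z r′)
        ≈⟨ unit _ ⟨
      Z r * Y r′ - Y r * Z r′ ∎
      where
      r′ = ℤ.suc r
      σ = sgn (length us)
      X = casoratian (2 ℕ.+ n) r (g ∷ us ++ f ∷ vs)
      W = casoratian n r′ (us ++ vs)
      Y Z : ℤ → Carrier
      Y r = casoratian (suc n) r (us ++ f ∷ vs)
      Z r = casoratian (suc n) r (g ∷ us ++ vs)

      insert : ∀ m r us →
        casoratian m r (f ∷ us ++ vs) ≈ sgn (length us) * casoratian m r (us ++ f ∷ vs)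
      insert m r us = alternating-insert (minor-alternating (rows m r)) us f vs

      unit : ∀ x → x ≈ σ * σ * x
      unit x = sym (trans (*-congʳ (sgn-square (length us))) (*-identityˡ x))

    -- `Λ n r` depends only on r + n, so every product carries the same two factors `Λ₀` and `Λ₁`.
    -- Since `τ` changes sign from r to r + 1, the product containing `τ r′` absorbs the minus sign
    -- of `hirota-casoratian`.
    hirota-entry : ∀ n b r f g us vs →
      entry (2 ℕ.+ n) (suc b) r (g ∷ us ++ f ∷ vs) * entry n b (ℤ.suc r) (us ++ vs) ≈
        entry (suc n) b r (us ++ f ∷ vs) *
          entry (suc n) (suc b) (ℤ.suc r) (g ∷ us ++ vs) +
        entry (suc n) (suc b) r (g ∷ us ++ vs) *
          entry (suc n) b (ℤ.suc r) (us ++ f ∷ vs)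
    hirota-entry n b r f g us vs = begin
      Λ₁ * (t * s) * X * (Λ₀ * s′ * W)
        ≈⟨ solve 7 (λ l₁ t s x l₀ s′ w → l₁ :* (t :* s) :* x :* (l₀ :* s′ :* w)
                                      := l₀ :* l₁ :* t :* s :* s′ :* (x :* w)) refl
             Λ₁ t s X Λ₀ s′ W ⟩
      Λ₀ * Λ₁ * t * s * s′ * (X * W)
        ≈⟨ *-congˡ (hirota-casoratian n r f g us vs) ⟩
      Λ₀ * Λ₁ * t * s * s′ * (Z r * Y r′ - Y r * Z r′)
        ≈⟨ solve 9 (λ l₀ l₁ t s s′ z y′ y z′ →
                l₀ :* l₁ :* t :* s :* s′ :* (z :* y′ :- y :* z′)
             := l₀ :* s :* y :* (l₁ :* (:- t :* s′) :* z′) :+ l₀ :* (t :* s) :* z :* (l₁ :* s′ :* y′))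
             refl Λ₀ Λ₁ t s s′ (Z r) (Y r′) (Y r) (Z r′) ⟩
      Λ₀ * s * Y r * (Λ₁ * (- t * s′) * Z r′) + Λ₀ * (t * s) * Z r * (Λ₁ * s′ * Y r′)
        ≈⟨ +-congʳ (*-congˡ (*-congʳ (*-congˡ (*-congʳ (τ-suc r))))) ⟨
      Λ₀ * s * Y r * (Λ₁ * (τ r′ * s′) * Z r′) + Λ₀ * (t * s) * Z r * (Λ₁ * s′ * Y r′) ∎
      where
      r′ = ℤ.suc r
      Λ₀ = Λ n r′
      Λ₁ = Λ (suc n) r′
      t = τ r
      s = τ^ b r
      s′ = τ^ b r′
      X = casoratian (2 ℕ.+ n) r (g ∷ us ++ f ∷ vs)
      W = casoratian n r′ (us ++ vs)
      Y Z : ℤ → Carrier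
      Y r = casoratian (suc n) r (us ++ f ∷ vs)
      Z r = casoratian (suc n) r (g ∷ us ++ vs)

    -- Outside this block only the boundary values and the equation matter; hiding the body keeps
    -- the determinants from unfolding in the slice computations.
    abstract

      h : ℕ → ℕ → ℤ → Carrier
      h a b r = entry (b ℕ.+ a) b r (G.columns b ++ F.columns a)

      h-boundaryˡ : ∀ a r → h a 0 r ≈ α a r
      h-boundaryˡ zero    r = trans (*-identityʳ _) (*-identityʳ _)
      h-boundaryˡ (suc a) r = begin
        Λ (suc a) r * 1# * casoratian (suc a) r (F.columns (suc a))
          ≈⟨ *-cong (*-identityʳ _) (F.casoratian-columns a r) ⟩
        Λ (suc a) r * (α (suc a) r * Λ⁻¹ (suc a) r)
          ≈⟨ solve 3 (λ l x l⁻¹ → l :* (x :* l⁻¹) := x :* (l :* l⁻¹)) refl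
               (Λ (suc a) r) (α (suc a) r) (Λ⁻¹ (suc a) r) ⟩
        α (suc a) r * (Λ (suc a) r * Λ⁻¹ (suc a) r)
          ≈⟨ *-congˡ (Λ-inverse (suc a) r) ⟩
        α (suc a) r * 1#
          ≈⟨ *-identityʳ _ ⟩
        α (suc a) r ∎

      h-boundaryʳ : ∀ b r → h 0 b r ≈ β b r
      h-boundaryʳ zero    r = trans (h-boundaryˡ 0 r) (α₀≈β₀ r)
      h-boundaryʳ (suc b) r = begin
        h 0 (suc b) r
          ≡⟨ ≡.cong₂ (λ n vs → entry n (suc b) r vs)
               (ℕ.+-identityʳ (suc b)) (++-identityʳ (G.columns (suc b))) ⟩
        Λ (suc b) r * s * casoratian (suc b) r (G.columns (suc b))
          ≈⟨ *-congˡ (G.casoratian-columns b r) ⟩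
        Λ (suc b) r * s * (s * β (suc b) r * Λ⁻¹ (suc b) r)
          ≈⟨ solve 4 (λ l s x l⁻¹ → l :* s :* (s :* x :* l⁻¹) := x :* ((s :* s) :* (l :* l⁻¹))) refl
               (Λ (suc b) r) s (β (suc b) r) (Λ⁻¹ (suc b) r) ⟩
        β (suc b) r * ((s * s) * (Λ (suc b) r * Λ⁻¹ (suc b) r))
          ≈⟨ *-congˡ (trans (*-cong (τ^-square (suc b) r) (Λ-inverse (suc b) r)) (*-identityˡ 1#)) ⟩
        β (suc b) r * 1#
          ≈⟨ *-identityʳ _ ⟩
        β (suc b) r ∎
        where
        s : Carrier
        s = τ^ (suc b) r

      hirota-miwa : ∀ a b r →
        h (suc a) (suc b) r * h a b (ℤ.suc r) ≈
          h (suc a) b r * h a (suc b) (ℤ.suc r) + h a (suc b) r * h (suc a) b (ℤ.suc r)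
      hirota-miwa a b r = shift (ℕ.+-suc b a)
        where
        -- `b ℕ.+ suc a` does not compute to `suc (b ℕ.+ a)`; with a variable in its place, matching
        -- on the equation aligns the sizes with those in `hirota-entry`.
        shift : ∀ {m} → m ≡ suc (b ℕ.+ a) →
          entry (suc m) (suc b) r (G.columns (suc b) ++ F.columns (suc a)) *
            entry (b ℕ.+ a) b (ℤ.suc r) (G.columns b ++ F.columns a) ≈
          entry m b r (G.columns b ++ F.columns (suc a)) *
            entry (suc b ℕ.+ a) (suc b) (ℤ.suc r) (G.columns (suc b) ++ F.columns a) +
          entry (suc b ℕ.+ a) (suc b) r (G.columns (suc b) ++ F.columns a) *
            entry m b (ℤ.suc r) (G.columns b ++ F.columns (suc a))
        shift ≡.refl =
            hirota-entry (b ℕ.+ a) b r (F.column a) (G.column b) (G.columns b) (F.columns a)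

open import Defs
open CommutativeRing laurentRing using (reflexive; setoid; *-congʳ; *-congˡ; *-identityʳ)
open IntegerCoefficientSolver laurentRing using (solve; _:=_; _:+_; _:*_)
open import Relation.Binary.Reasoning.Setoid setoid

-- Evaluation at x = 1

eval : Laurent → ℤ
eval (x i j)   = 1ℤ
eval (x⁻¹ i j) = 1ℤ
eval 0#        = ℤ.0ℤ
eval 1#        = 1ℤ
eval (p + q)   = eval p ℤ.+ eval q
eval (p * q)   = eval p ℤ.* eval q
eval (- p)     = ℤ.- eval p

eval-cong : ∀ {p q} → p ≈ q → eval p ≡ eval q
eval-cong refl               = ≡.refl
eval-cong (sym p)            = ≡.sym (eval-cong p)
eval-cong (trans p q)        = ≡.trans (eval-cong p) (eval-cong q)
eval-cong (+-cong p q)       = ≡.cong₂ ℤ._+_ (eval-cong p) (eval-cong q)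
eval-cong (*-cong p q)       = ≡.cong₂ ℤ._*_ (eval-cong p) (eval-cong q)
eval-cong (-‿cong p)         = ≡.cong ℤ.-_ (eval-cong p)
eval-cong (+-assoc p q r)    = ℤ.+-assoc (eval p) (eval q) (eval r)
eval-cong (+-comm p q)       = ℤ.+-comm (eval p) (eval q)
eval-cong (+-identityˡ p)    = ℤ.+-identityˡ (eval p)
eval-cong (-‿inverseˡ p)     = ℤ.+-inverseˡ (eval p)
eval-cong (*-assoc p q r)    = ℤ.*-assoc (eval p) (eval q) (eval r)
eval-cong (*-comm p q)       = ℤ.*-comm (eval p) (eval q)
eval-cong (*-identityˡ p)    = ℤ.*-identityˡ (eval p)
eval-cong (distribˡ p q r)   = ℤ.*-distribˡ-+ (eval p) (eval q) (eval r)
eval-cong (x-inverseʳ i j)   = ≡.refl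

-- Sums of nonzero elements can vanish, sums of positive ones cannot. The form `+ suc n` is
-- reproduced by computation under sums and products.
data Positive (p : Laurent) : Set where
  positive : ∀ {n} → eval p ≡ + suc n → Positive p

positive-+ : ∀ {p q} → Positive p → Positive q → Positive (p + q)
positive-+ (positive p) (positive q) = positive (≡.cong₂ ℤ._+_ p q)

positive-* : ∀ {p q} → Positive p → Positive q → Positive (p * q)
positive-* (positive p) (positive q) = positive (≡.cong₂ ℤ._*_ p q)

positive⇒≉0 : ∀ {p} → Positive p → p ≉ 0#
positive⇒≉0 (positive p) p≈0 with () ← ≡.trans (≡.sym p) (eval-cong p≈0)

-- The numerator is kept positive because it enters the denominator of a quotient.
infix 4 _⊨_

record _⊨_ (p : Laurent) (u : Fraction) : Set where
  field
    num-positive : Positive (num u)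
    den-positive : Positive (den u)
    value        : p * den u ≈ num u

open _⊨_

⊨⇒≐ : ∀ {p u} → p ⊨ u → p ≐ u
⊨⇒≐ p⊨u = positive⇒≉0 (den-positive p⊨u) , value p⊨u

⊨-· : ∀ {p q u v} → p ⊨ u → q ⊨ v → p * q ⊨ u · v
⊨-· {p} {q} {u} {v} p⊨u q⊨v = record
  { num-positive = positive-* (num-positive p⊨u) (num-positive q⊨v)
  ; den-positive = positive-* (den-positive p⊨u) (den-positive q⊨v)
  ; value = trans
      (solve 4 (λ p q d e → p :* q :* (d :* e) := p :* d :* (q :* e)) refl p q (den u) (den v))
      (*-cong (value p⊨u) (value q⊨v)) }

⊨-⊕ : ∀ {p q u v} → p ⊨ u → q ⊨ v → p + q ⊨ u ⊕ v
⊨-⊕ {p} {q} {u} {v} p⊨u q⊨v = record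
  { num-positive = positive-+ (positive-* (num-positive p⊨u) (den-positive q⊨v))
                              (positive-* (num-positive q⊨v) (den-positive p⊨u))
  ; den-positive = positive-* (den-positive p⊨u) (den-positive q⊨v)
  ; value = trans
      (solve 4 (λ p q d e → (p :+ q) :* (d :* e) := p :* d :* e :+ q :* e :* d) refl
        p q (den u) (den v))
      (+-cong (*-congʳ (value p⊨u)) (*-congʳ (value q⊨v))) }

-- The quotient is certified by its product with the divisor, the form in which the Hirota-Miwa
-- equation determines f at (a + 1, b + 1).
⊨-÷ : ∀ {p q r u v} → r * q ≈ p → p ⊨ u → q ⊨ v → r ⊨ u ÷ v
⊨-÷ {p} {q} {r} {u} {v} rq≈p p⊨u q⊨v = record
  { num-positive = positive-* (num-positive p⊨u) (den-positive q⊨v)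
  ; den-positive = positive-* (den-positive p⊨u) (num-positive q⊨v)
  ; value = begin
      r * (den u * num v)
        ≈⟨ *-congˡ (*-congˡ (value q⊨v)) ⟨
      r * (den u * (q * den v))
        ≈⟨ solve 4 (λ r d q e → r :* (d :* (q :* e)) := r :* q :* d :* e) refl
             r (den u) q (den v) ⟩
      r * q * den u * den v
        ≈⟨ *-congʳ (trans (*-congʳ rq≈p) (value p⊨u)) ⟩
      num u * den v ∎ }

⊨-X : ∀ {p i j} → p ≈ x i j → p ⊨ X i j
⊨-X p≈x = record
  { num-positive = positive ≡.refl
  ; den-positive = positive ≡.refl
  ; value = trans (*-identityʳ _) p≈x }

-- Values of ψ as values of a solution of the Hirota-Miwa equation

module Representation
  (f : ℕ → ℕ → ℤ → ℤ → Laurent)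
  (f-boundaryˡ : ∀ a i j → f a 0 i j ≈ x i j)
  (f-boundaryʳ : ∀ b i j → f 0 b i j ≈ x i j)
  (f-hirota : ∀ a b i j →
    f (suc a) (suc b) i j * f a b i j
      ≈ f (suc a) b (i ℤ.- 1ℤ) j * f a (suc b) (i ℤ.+ 1ℤ) j
        + f a (suc b) i (j ℤ.- 1ℤ) * f (suc a) b i (j ℤ.+ 1ℤ))
  where

  ⊨-top : ∀ k {a b i j} → a ≡ suc k → a ℕ.+ b ≡ suc k → f a b i j ⊨ X i j
  ⊨-top k {a} {b} {i} {j} ≡.refl a+b≡a
    with ≡.refl ← ℕ.+-cancelˡ-≡ (suc k) b 0 (≡.trans a+b≡a (≡.sym (ℕ.+-identityʳ (suc k))))
    = ⊨-X (f-boundaryˡ (suc k) i j)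

  -- Under a = t and a + b = k + 1, the recursion for `ψ` is the Hirota-Miwa equation solved for its
  -- value at (a + 1, b + 1).
  ⊨-ψ : ∀ k t i j {a b} → a ≡ toℕ t → a ℕ.+ b ≡ suc k → f a b i j ⊨ ψ k t i j
  ⊨-ψ k zero i j {b = b} ≡.refl _ = ⊨-X (f-boundaryʳ b i j)
  ⊨-ψ k (suc t) i j a≡t a+b≡1+k with view t
  ⊨-ψ k (suc .(fromℕ k)) i j a≡t a+b≡1+k | ‵fromℕ =
    ⊨-top k (≡.trans a≡t (≡.cong suc (Fin.toℕ-fromℕ k))) a+b≡1+k
  -- The divisor here is x itself, which is f at the origin a = b = 0.
  ⊨-ψ (suc zero) (suc .(inject₁ zero)) i j ≡.refl ≡.refl | ‵inject₁ zero =
    ⊨-÷ (f-hirota 0 0 i j)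
      (⊨-⊕ (⊨-· (⊨-X (f-boundaryˡ 1 _ j)) (⊨-X (f-boundaryʳ 1 _ j)))
           (⊨-· (⊨-X (f-boundaryʳ 1 i _)) (⊨-X (f-boundaryˡ 1 i _))))
      (⊨-X (f-boundaryʳ 0 i j))
  -- b = 0 would force the top value k + 3 of the index, which `view` has split off.
  ⊨-ψ (suc (suc k)) (suc .(inject₁ t)) i j {suc a} {zero} 1+a≡1+t eq | ‵inject₁ t =
    ⊥-elim (ℕ.<-irrefl a≡2+k (≡.subst (ℕ._< 2 ℕ.+ k) (≡.sym a≡t) (Fin.toℕ<n t)))
    where
    a≡t : a ≡ toℕ t
    a≡t = ≡.trans (ℕ.suc-injective 1+a≡1+t) (Fin.toℕ-inject₁ t)
    a≡2+k : a ≡ 2 ℕ.+ k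
    a≡2+k = ≡.trans (≡.sym (ℕ.+-identityʳ a)) (ℕ.suc-injective eq)
  ⊨-ψ (suc (suc k)) (suc .(inject₁ t)) i j {suc a} {suc b} 1+a≡1+t eq | ‵inject₁ t =
    ⊨-÷ (f-hirota a b i j)
      (⊨-⊕ (⊨-· (⊨-ψ (suc k) (suc t) _ j (≡.cong suc a≡t) 1+a+b≡2+k)
                (⊨-ψ (suc k) (inject₁ t) _ j (ℕ.suc-injective 1+a≡1+t) (ℕ.suc-injective eq)))
           (⊨-· (⊨-ψ (suc k) (inject₁ t) i _ (ℕ.suc-injective 1+a≡1+t) (ℕ.suc-injective eq))
                (⊨-ψ (suc k) (suc t) i _ (≡.cong suc a≡t) 1+a+b≡2+k)))
      (⊨-ψ k t i j a≡t (ℕ.suc-injective 1+a+b≡2+k))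
    where
    a≡t : a ≡ toℕ t
    a≡t = ≡.trans (ℕ.suc-injective 1+a≡1+t) (Fin.toℕ-inject₁ t)
    1+a+b≡2+k : suc a ℕ.+ b ≡ 2 ℕ.+ k
    1+a+b≡2+k = ≡.trans (≡.sym (ℕ.+-suc a b)) (ℕ.suc-injective eq)

-- The point (a , b , i , j) lies on the slice c = a - b + i - j, which the equation
-- preserves; on a slice the points are indexed by a, b and r = i - b.

open Casoratians laurentRing using (Invertible; module HirotaMiwa)

x-invertible : ∀ i j → Invertible (x i j)
x-invertible i j = x⁻¹ i j , x-inverseʳ i j

module Slice (c : ℤ) = HirotaMiwa
  -- On the slice i = r + b and j = a - b + i - c; here b = 0, and in the next line a = 0.
  (λ a r → x r (+ a ℤ.+ r ℤ.- c))
  (λ b r → x (r ℤ.+ + b) (r ℤ.- c))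
  (λ a r → x-invertible _ _)
  (λ b r → x-invertible _ _)
  (λ r → reflexive (≡.cong₂ (λ s t → x s (t ℤ.- c)) (≡.sym (ℤ.+-identityʳ r)) (ℤ.+-identityˡ r)))

slice : ℤ → ℤ → ℤ → ℤ → ℤ
slice a b i j = a ℤ.- b ℤ.+ (i ℤ.- j)

f : ℕ → ℕ → ℤ → ℤ → Laurent
f a b i j = Slice.h (slice (+ a) (+ b) i j) a b (i ℤ.- + b)

f-at : ∀ a b i j {c r} → slice (+ a) (+ b) i j ≡ c → i ℤ.- + b ≡ r → f a b i j ≡ Slice.h c a b r
f-at a b _ _ = ≡.cong₂ (λ c r → Slice.h c a b r)

f-boundaryˡ : ∀ a i j → f a 0 i j ≈ x i j
f-boundaryˡ a i j = trans (Slice.h-boundaryˡ (slice (+ a) (+ 0) i j) a (i ℤ.- + 0))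
  (reflexive (≡.cong₂ x (ℤ.+-identityʳ i) (column (+ a) i j)))
  where
  column : ∀ a i j → a ℤ.+ (i ℤ.- ℤ.0ℤ) ℤ.- (a ℤ.- ℤ.0ℤ ℤ.+ (i ℤ.- j)) ≡ j
  column = solve-∀

f-boundaryʳ : ∀ b i j → f 0 b i j ≈ x i j
f-boundaryʳ b i j = trans (Slice.h-boundaryʳ (slice (+ 0) (+ b) i j) b (i ℤ.- + b))
  (reflexive (≡.cong₂ x (row (+ b) i) (column (+ b) i j)))
  where
  row : ∀ b i → i ℤ.- b ℤ.+ b ≡ i
  row = solve-∀
  column : ∀ b i j → i ℤ.- b ℤ.- (ℤ.0ℤ ℤ.- b ℤ.+ (i ℤ.- j)) ≡ j
  column = solve-∀

f-hirota : ∀ a b i j →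
  f (suc a) (suc b) i j * f a b i j
    ≈ f (suc a) b (i ℤ.- 1ℤ) j * f a (suc b) (i ℤ.+ 1ℤ) j
      + f a (suc b) i (j ℤ.- 1ℤ) * f (suc a) b i (j ℤ.+ 1ℤ)
f-hirota a b i j = begin
  f (suc a) (suc b) i j * f a b i j
    ≡⟨ ≡.cong₂ _*_ (f-at (suc a) (suc b) i j (c₁ A B i j) ≡.refl) (f-at a b i j ≡.refl (r₂ B i)) ⟩
  h (suc a) (suc b) r * h a b (ℤ.suc r)
    ≈⟨ Slice.hirota-miwa c a b r ⟩
  h (suc a) b r * h a (suc b) (ℤ.suc r) + h a (suc b) r * h (suc a) b (ℤ.suc r)
    ≡⟨ ≡.cong₂ _+_
         (≡.cong₂ _*_ (f-at (suc a) b (i ℤ.- 1ℤ) j (c₃ A B i j) (r₃ B i))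
                      (f-at a (suc b) (i ℤ.+ 1ℤ) j (c₄ A B i j) (r₄ B i)))
         (≡.cong₂ _*_ (f-at a (suc b) i (j ℤ.- 1ℤ) (c₅ A B i j) ≡.refl)
                      (f-at (suc a) b i (j ℤ.+ 1ℤ) (c₆ A B i j) (r₂ B i))) ⟨
  f (suc a) b (i ℤ.- 1ℤ) j * f a (suc b) (i ℤ.+ 1ℤ) j
    + f a (suc b) i (j ℤ.- 1ℤ) * f (suc a) b i (j ℤ.+ 1ℤ) ∎
  where
  A = + a
  B = + b
  c = slice A B i j
  -- Each of the six points has its row, first coordinate minus b-index, equal to this r or to r +
  -- 1.
  r = i ℤ.- ℤ.suc B
  h = Slice.h c

  c₁ : ∀ a b i j → 1ℤ ℤ.+ a ℤ.- (1ℤ ℤ.+ b) ℤ.+ (i ℤ.- j) ≡ a ℤ.- b ℤ.+ (i ℤ.- j)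
  c₁ = solve-∀
  c₃ : ∀ a b i j → 1ℤ ℤ.+ a ℤ.- b ℤ.+ (i ℤ.- 1ℤ ℤ.- j) ≡ a ℤ.- b ℤ.+ (i ℤ.- j)
  c₃ = solve-∀
  c₄ : ∀ a b i j → a ℤ.- (1ℤ ℤ.+ b) ℤ.+ (i ℤ.+ 1ℤ ℤ.- j) ≡ a ℤ.- b ℤ.+ (i ℤ.- j)
  c₄ = solve-∀
  c₅ : ∀ a b i j → a ℤ.- (1ℤ ℤ.+ b) ℤ.+ (i ℤ.- (j ℤ.- 1ℤ)) ≡ a ℤ.- b ℤ.+ (i ℤ.- j)
  c₅ = solve-∀
  c₆ : ∀ a b i j → 1ℤ ℤ.+ a ℤ.- b ℤ.+ (i ℤ.- (j ℤ.+ 1ℤ)) ≡ a ℤ.- b ℤ.+ (i ℤ.- j)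
  c₆ = solve-∀
  r₂ : ∀ b i → i ℤ.- b ≡ 1ℤ ℤ.+ (i ℤ.- (1ℤ ℤ.+ b))
  r₂ = solve-∀
  r₃ : ∀ b i → i ℤ.- 1ℤ ℤ.- b ≡ i ℤ.- (1ℤ ℤ.+ b)
  r₃ = solve-∀
  r₄ : ∀ b i → i ℤ.+ 1ℤ ℤ.- (1ℤ ℤ.+ b) ≡ 1ℤ ℤ.+ (i ℤ.- (1ℤ ℤ.+ b))
  r₄ = solve-∀

open Representation f f-boundaryˡ f-boundaryʳ f-hirota

proposition3p14 : Σ[ f ∈ (ℕ → ℕ → ℤ → ℤ → Laurent) ]
    ( (∀ (k : ℕ) (t : Fin (suc (suc k))) (i j : ℤ) → f (toℕ t) (suc k ∸ toℕ t) i j ≐ ψ k t i j)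
    × (∀ (i j : ℤ) → f 0 0 i j ≈ x i j)
    × (∀ (b : ℕ) (i j : ℤ) → f 0 b i j ≈ x i j)
    × (∀ (a : ℕ) (i j : ℤ) → f a 0 i j ≈ x i j)
    × (∀ (a b : ℕ) (i j : ℤ) →
    f (suc a) (suc b) i j * f a b i j
    ≈ f (suc a) b (i ℤ.- 1ℤ) j * f a (suc b) (i ℤ.+ 1ℤ) j
    + f a (suc b) i (j ℤ.- 1ℤ) * f (suc a) b i (j ℤ.+ 1ℤ)) )
proposition3p14 =
  f ,
  -- As t ≤ k + 1, the truncated difference is exact.
  (λ k t i j → ⊨⇒≐ (⊨-ψ k t i j ≡.refl (ℕ.m+[n∸m]≡n (ℕ.s≤s⁻¹ (Fin.toℕ<n t))))) ,
  f-boundaryʳ 0 , f-boundaryʳ , f-boundaryˡ , f-hirota
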